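{- For every $n\ge 1$ we have $tt(n)\le 12$.
   Context: A permutation is any finite sequence of distinct positive integers; an $n$-permutation is a permutation of $[n]=\{1,\dots,n\}$. Two permutations $(x_1,\dots,x_k)$ and $(y_1,\dots,y_k)$ are similar if $x_i<x_j \iff y_i<y_j$ for all $1\le i<j\le k$. A pair of twins in $\pi$ is a pair of similar subsequences of $\pi$ with disjoint index sets; its length is the number of entries of one of them. A pair of twins is tight if the union of their index sets is a segment of consecutive integers. $tt(\pi)$ is the maximum length of a pair of tight twins in $\pi$ and $tt(n)=\min\{tt(\pi):\pi\text{ an } n\text{ -permutation}\}$. -}

module Defs where

open import Data.Nat using (ℕ; _≤_; _<_)
open import Data.Fin using (Fin; toℕ)
open import Data.Fin.Permutation using (Permutation′; _⟨$⟩ʳ_)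
open import Data.Product using (_×_; ∃-syntax)
open import Data.Sum using (_⊎_)
open import Relation.Nullary using (¬_)
open import Relation.Binary.PropositionalEquality using (_≡_)
open import Function.Bundles using (_⇔_)

-- An n-permutation π of [n], represented 0-based as a bijection Fin n ↔ Fin n;
-- π ⟨$⟩ʳ i is the (i+1)-th entry (shifted down by 1, which does not affect order).

-- A subsequence of length k of a sequence of length n is given by its index
-- set, i.e. a strictly increasing map Fin k → Fin n.
StrictlyIncreasing : ∀ {k n} → (Fin k → Fin n) → Set
StrictlyIncreasing {k} f = ∀ (i j : Fin k) → toℕ i < toℕ j → toℕ (f i) < toℕ (f j)

Similar : ∀ {k n} → Permutation′ n → (Fin k → Fin n) → (Fin k → Fin n) → Set
Similar {k} π f g =
  ∀ (i j : Fin k) → toℕ i < toℕ j →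
    (toℕ (π ⟨$⟩ʳ f i) < toℕ (π ⟨$⟩ʳ f j)) ⇔ (toℕ (π ⟨$⟩ʳ g i) < toℕ (π ⟨$⟩ʳ g j))

Disjoint : ∀ {k n} → (Fin k → Fin n) → (Fin k → Fin n) → Set
Disjoint {k} f g = ∀ (i j : Fin k) → ¬ (f i ≡ g j)

InUnion : ∀ {k n} → (Fin k → Fin n) → (Fin k → Fin n) → Fin n → Set
InUnion {k} f g m = (∃[ i ] f i ≡ m) ⊎ (∃[ i ] g i ≡ m)

Twins : ∀ {n} → Permutation′ n → (k : ℕ) → (Fin k → Fin n) → (Fin k → Fin n) → Set
Twins π k f g = StrictlyIncreasing f × StrictlyIncreasing g × Disjoint f g × Similar π f g

IsSegmentUnion : ∀ {k n} → (Fin k → Fin n) → (Fin k → Fin n) → Set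
IsSegmentUnion {k} {n} f g =
  ∃[ a ] ∃[ b ] (∀ (m : Fin n) → ((a ≤ toℕ m × toℕ m ≤ b) ⇔ InUnion f g m))

TightTwins : ∀ {n} → Permutation′ n → (k : ℕ) → (Fin k → Fin n) → (Fin k → Fin n) → Set
TightTwins π k f g = Twins π k f g × IsSegmentUnion f g

ttAtMost : ∀ {n} → Permutation′ n → ℕ → Set
ttAtMost {n} π t = ∀ (k : ℕ) (f g : Fin k → Fin n) → TightTwins π k f g → k ≤ t

ttNAtMost : ℕ → ℕ → Set
ttNAtMost n t = ∃[ π ] ttAtMost {n} π t

{-# OPTIONS --safe #-}
module Submission where

-- Rosenfeld's counting argument. Let c(k) be the number of words of length k over {0, …, N - 1} with
-- distinct letters and no tight twins longer than 12, where N = 200 n. Then c(k + 1) ≥ (97/100) N c(k)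
-- for k < n. Indeed, if an extension by one letter creates twins of length r, then removing these twins
-- leaves a good word of length k + 1 - 2r, and by induction c(k + 1 - 2r) ≤ c(k) / (97N/100)^(2r - 1).
-- On the other hand at most 2^(2r-1) N^(2r) / r! words of length 2r consist of twins, because the second
-- twin is determined by the first one and its own set of letters. Summed over r ≥ 13, twins cost at most
-- 1/40 of the N c(k) extensions, and repeated letters cost at most 1/200. Hence c(n) > 0, and
-- standardizing a good word of length n gives the permutation.

open import Defs
open import Data.Bool using (Bool; true; false; not)
open import Data.Empty using (⊥-elim)
open import Data.Fin as Fin using (Fin; zero; suc; toℕ; fromℕ<)
open import Data.Fin.Permutation using (permutation; _⟨$⟩ʳ_)
import Data.Fin.Properties as Fin
open import Data.List using (List; []; _∷_; _++_; map; length; filter; cartesianProduct; cartesianProductWith; upTo; applyUpTo; iterate; take; drop; tabulate)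
open import Data.List.Membership.Propositional using (_∈_; _∉_; lose)
open import Data.List.Membership.Propositional.Properties
open import Data.List.Properties
open import Data.List.Relation.Binary.Permutation.Propositional using (↭-sym; ↭⇒↭ₛ)
open import Data.List.Relation.Binary.Permutation.Propositional.Properties using (shift; ↭-length; ∈-resp-↭; All-resp-↭; filter-↭)
open import Data.List.Relation.Binary.Subset.Propositional using (_⊆_)
open import Data.List.Relation.Unary.All as All using (All; []; _∷_)
import Data.List.Relation.Unary.All.Properties as All
open import Data.List.Relation.Unary.AllPairs as AllPairs using (AllPairs; []; _∷_)
import Data.List.Relation.Unary.AllPairs.Properties as AllPairs
open import Data.List.Relation.Unary.Any using (Any; here; there; any?)
open import Data.List.Relation.Unary.Sorted.TotalOrder.Properties using (Sorted⇒AllPairs)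
open import Data.List.Relation.Unary.Unique.Propositional using (Unique)
import Data.List.Relation.Unary.Unique.Propositional.Properties as Unique
import Data.List.Sort as Sort
open import Data.Nat using (ℕ; zero; suc; pred; _+_; _*_; _∸_; _^_; _!; _⊓_; _≤_; _<_; _>_; _≤?_; _<?_; z≤n; s≤s; z<s; s<s; s≤s⁻¹; NonZero)
open import Data.Nat.Induction using (<-rec)
open import Data.Nat.ListAction using (sum)
open import Data.Nat.Properties
open import Data.Nat.Tactic.RingSolver using (solve-∀)
open import Data.Product using (_×_; _,_; ∃₂; ∃-syntax; proj₁; proj₂)
open import Data.Sum using (_⊎_; inj₁; inj₂; [_,_]′)
open import Data.Unit using (⊤; tt)
open import Function using (_∘_; id; flip)
open import Function.Bundles using (Equivalence)
open import Relation.Binary using (tri<; tri≈; tri>)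
open import Relation.Binary.Properties.DecTotalOrder using (≥-decTotalOrder)
open import Relation.Binary.Properties.TotalOrder using (≥-totalOrder)
open import Relation.Binary.PropositionalEquality as ≡ using (_≡_; _≢_; refl; sym; trans; cong; cong₂; subst; subst₂)
open import Relation.Nullary using (¬_; Dec; yes; no; contradiction; ¬?; _×-dec_; _⊎-dec_)
open import Relation.Nullary.Decidable using (decidable-stable)
open import Relation.Unary using (Decidable)
open import Data.List.Membership.DecPropositional _≟_ using (_∈?_)
open import Data.List.Membership.DecPropositional (≡-dec _≟_) using () renaming (_∈?_ to _∈ʷ?_)
open import Data.List.Relation.Binary.Permutation.Setoid.Properties (≡.setoid ℕ) using (Unique-resp-↭)
open Sort (≥-decTotalOrder ≤-decTotalOrder) using (sort; sort-↭; sort-↗)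

-- Counting in lists

module _ {A : Set} where

  -- Each element of `xs` is deleted from `ys` in turn; distinctness keeps the later ones in what
  -- remains. The injections behind all the counts below are applied in this form.
  length-⊆ : ∀ {xs ys : List A} → Unique xs → xs ⊆ ys → length xs ≤ length ys
  length-⊆ {[]}     _            _     = z≤n
  length-⊆ {x ∷ xs} (x∉xs ∷ xs!) xs⊆ys with ∈-∃++ (xs⊆ys (here refl))
  ... | as , bs , refl =
    subst (suc (length xs) ≤_) (sym (↭-length (shift x as bs))) (s≤s (length-⊆ xs! xs⊆as++bs))
    where
    xs⊆as++bs : xs ⊆ as ++ bs
    xs⊆as++bs y∈xs with ∈-resp-↭ (shift x as bs) (xs⊆ys (there y∈xs))
    ... | here refl = contradiction refl (All.lookup x∉xs y∈xs)
    ... | there y∈  = y∈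

  module _ {P Q R : A → Set} (P? : Decidable P) (Q? : Decidable Q) (R? : Decidable R) where

    length-filter-⊎ : (∀ {x} → P x → Q x ⊎ R x) →
                      ∀ xs → length (filter P? xs) ≤ length (filter Q? xs) + length (filter R? xs)
    length-filter-⊎ P⇒Q⊎R []       = z≤n
    length-filter-⊎ P⇒Q⊎R (x ∷ xs) with length-filter-⊎ P⇒Q⊎R xs | P? x | Q? x | R? x
    ... | ih | no _  | no _  | no _  = ih
    ... | ih | no _  | no _  | yes _ = ≤-trans ih (+-monoʳ-≤ _ (n≤1+n _))
    ... | ih | no _  | yes _ | no _  = m≤n⇒m≤1+n ih
    ... | ih | no _  | yes _ | yes _ = m≤n⇒m≤1+n (≤-trans ih (+-monoʳ-≤ _ (n≤1+n _)))
    ... | ih | yes p | no ¬q | no ¬r = ⊥-elim ([ ¬q , ¬r ]′ (P⇒Q⊎R p))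
    ... | ih | yes _ | no _  | yes _ = ≤-trans (s≤s ih) (≤-reflexive (sym (+-suc _ _)))
    ... | ih | yes _ | yes _ | no _  = s≤s ih
    ... | ih | yes _ | yes _ | yes _ = s≤s (≤-trans ih (+-monoʳ-≤ _ (n≤1+n _)))

  length-filter-∁ : ∀ {P : A → Set} (P? : Decidable P) xs →
                    length xs ≤ length (filter (¬? ∘ P?) xs) + length (filter P? xs)
  length-filter-∁ P? []       = z≤n
  length-filter-∁ P? (x ∷ xs) with length-filter-∁ P? xs | P? x
  ... | ih | yes _ = ≤-trans (s≤s ih) (≤-reflexive (sym (+-suc _ _)))
  ... | ih | no _  = s≤s ih

  length-filter-Any : ∀ {I : Set} {P : I → A → Set} (P? : ∀ i → Decidable (P i)) is xs →
                      length (filter (λ x → any? (λ i → P? i x) is) xs) ≤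
                      sum (map (λ i → length (filter (P? i) xs)) is)
  length-filter-Any {P = P} P? []       []       = z≤n
  length-filter-Any {P = P} P? []       (x ∷ xs) = length-filter-Any P? [] xs
  length-filter-Any {P = P} P? (i ∷ is) xs       =
    ≤-trans (length-filter-⊎ (λ x → any? (λ j → P? j x) (i ∷ is)) (P? i) (λ x → any? (λ j → P? j x) is) split xs)
            (+-monoʳ-≤ _ (length-filter-Any P? is xs))
    where
    split : ∀ {x} → Any (λ j → P j x) (i ∷ is) → P i x ⊎ Any (λ j → P j x) is
    split (here p)  = inj₁ p
    split (there p) = inj₂ p

length-cartesianProductWith : ∀ {A B C : Set} (f : A → B → C) xs ys →
                              length (cartesianProductWith f xs ys) ≡ length xs * length ys
length-cartesianProductWith f []       ys = refl
length-cartesianProductWith f (x ∷ xs) ys =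
  trans (length-++ (map (f x) ys))
        (cong₂ _+_ (length-map (f x) ys) (length-cartesianProductWith f xs ys))

words : ∀ {A : Set} → ℕ → List A → List (List A)
words zero    as = [] ∷ []
words (suc k) as = cartesianProductWith _∷_ as (words k as)

length-words : ∀ {A : Set} k (as : List A) → length (words k as) ≡ length as ^ k
length-words zero    as = refl
length-words (suc k) as =
  trans (length-cartesianProductWith _∷_ as (words k as)) (cong (length as *_) (length-words k as))

∈-words : ∀ {A : Set} {as xs : List A} → All (_∈ as) xs → xs ∈ words (length xs) as
∈-words []           = here refl
∈-words (x∈as ∷ xs⊆) = ∈-cartesianProductWith⁺ _∷_ x∈as (∈-words xs⊆)

-- The `r`-element subsets of {0, ..., n - 1}, each listed once in decreasing order. The recursion
-- is Pascal's rule, split on whether the largest candidate is chosen.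
descending : ℕ → ℕ → List (List ℕ)
descending zero    n       = [] ∷ []
descending (suc r) zero    = []
descending (suc r) (suc n) = map (n ∷_) (descending r n) ++ descending (suc r) n

∈-descending : ∀ {xs} n → AllPairs _>_ xs → All (_< n) xs → xs ∈ descending (length xs) n
∈-descending {[]}     n       _           _           = here refl
∈-descending {x ∷ xs} (suc n) (x>xs ∷ xs↘) (x<n ∷ xs<n) with x ≟ n
... | yes refl = ∈-++⁺ˡ (∈-map⁺ (n ∷_) (∈-descending n xs↘ x>xs))
... | no x≢n   = ∈-++⁺ʳ _ (∈-descending n (x>xs ∷ xs↘)
                   (x<n′ ∷ All.map (λ y<x → <-trans y<x x<n′) x>xs))
  where x<n′ = ≤∧≢⇒< (s≤s⁻¹ x<n) x≢n

-- The left side consists of the two leading terms of the binomial expansion of the right side.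
bernoulli : ∀ n r → suc r * n ^ r + n ^ suc r ≤ suc n ^ suc r
bernoulli n zero    = ≤-refl
bernoulli n (suc r) = begin
  suc (suc r) * n ^ suc r + n ^ suc (suc r)
    ≡⟨ lhs n r (n ^ r) ⟩
  n * (suc r * n ^ r + n ^ suc r) + n ^ suc r
    ≤⟨ +-mono-≤ (*-monoʳ-≤ n (bernoulli n r)) (^-monoˡ-≤ (suc r) (n≤1+n n)) ⟩
  n * suc n ^ suc r + suc n ^ suc r
    ≡⟨ +-comm (n * suc n ^ suc r) _ ⟩
  suc n ^ suc (suc r) ∎
  where
  open ≤-Reasoning
  lhs : ∀ n r p → suc (suc r) * (n * p) + n * (n * p) ≡ n * (suc r * p + n * p) + n * p
  lhs = solve-∀

-- The recursion of `descending` reduces this bound on the binomial coefficient to `bernoulli`.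
!*length-descending : ∀ r n → r ! * length (descending r n) ≤ n ^ r
!*length-descending zero    n       = ≤-refl
!*length-descending (suc r) zero    = ≤-reflexive (*-zeroʳ (suc r !))
!*length-descending (suc r) (suc n) = begin
  suc r ! * length (map (n ∷_) (descending r n) ++ descending (suc r) n)
    ≡⟨ cong (suc r ! *_) (trans (length-++ (map (n ∷_) (descending r n)))
         (cong (_+ length (descending (suc r) n)) (length-map (n ∷_) (descending r n)))) ⟩
  suc r * r ! * (c + d)
    ≡⟨ rearrange (suc r) (r !) c d ⟩
  suc r * (r ! * c) + suc r * r ! * d
    ≤⟨ +-mono-≤ (*-monoʳ-≤ (suc r) (!*length-descending r n)) (!*length-descending (suc r) n) ⟩
  suc r * n ^ r + n ^ suc r
    ≤⟨ bernoulli n r ⟩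
  suc n ^ suc r ∎
  where
  open ≤-Reasoning
  c = length (descending r n)
  d = length (descending (suc r) n)
  rearrange : ∀ a b c d → a * b * (c + d) ≡ a * (b * c) + a * b * d
  rearrange = solve-∀

-- Enumeration of twins

-- The value 0 is a default beyond the end, so that a position can be any natural number.
entry : List ℕ → ℕ → ℕ
entry []       _       = 0
entry (x ∷ xs) zero    = x
entry (x ∷ xs) (suc i) = entry xs i

∈⇒entry : ∀ {x xs} → x ∈ xs → ∃[ i ] i < length xs × entry xs i ≡ x
∈⇒entry (here refl) = zero , z<s , refl
∈⇒entry (there x∈) with ∈⇒entry x∈
... | i , i<n , eq = suc i , s<s i<n , eq

entry-∈ : ∀ {xs i} → i < length xs → entry xs i ∈ xs
entry-∈ {x ∷ xs} {zero}  _         = here refl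
entry-∈ {x ∷ xs} {suc i} (s<s i<n) = there (entry-∈ i<n)

entry-injective : ∀ {xs i j} → Unique xs → i < length xs → j < length xs →
                  entry xs i ≡ entry xs j → i ≡ j
entry-injective {x ∷ xs} {zero}  {zero}  _          _         _         _  = refl
entry-injective {x ∷ xs} {zero}  {suc j} (x∉xs ∷ _) _         (s<s j<n) eq =
  contradiction eq (All.lookup x∉xs (entry-∈ j<n))
entry-injective {x ∷ xs} {suc i} {zero}  (x∉xs ∷ _) (s<s i<n) _         eq =
  contradiction (sym eq) (All.lookup x∉xs (entry-∈ i<n))
entry-injective {x ∷ xs} {suc i} {suc j} (_ ∷ xs!)  (s<s i<n) (s<s j<n) eq =
  cong suc (entry-injective xs! i<n j<n eq)

above : ℕ → List ℕ → ℕ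
above x xs = length (filter (x <?_) xs)

-- In a decreasing list the entries greater than `x` are exactly those in front of it, so their
-- number is its position.
entry-above : ∀ {x xs} → AllPairs _>_ xs → x ∈ xs → entry xs (above x xs) ≡ x
entry-above {x} {.x ∷ xs} (x>xs ∷ _) (here refl)
  rewrite filter-reject (x <?_) {x} {xs} (<-irrefl refl)
        | filter-none (x <?_) (All.map <⇒≯ x>xs) = refl
entry-above {x} {y ∷ xs} (y>xs ∷ xs↘) (there x∈xs)
  rewrite filter-accept (x <?_) {y} {xs} (All.lookup y>xs x∈xs) = entry-above xs↘ x∈xs

length-filter-tabulate : ∀ {A B : Set} {P : A → Set} {Q : B → Set} (P? : Decidable P) (Q? : Decidable Q)
                         {k} (f : Fin k → A) (g : Fin k → B) →
                         (∀ i → P (f i) → Q (g i)) → (∀ i → Q (g i) → P (f i)) →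
                         length (filter P? (tabulate f)) ≡ length (filter Q? (tabulate g))
length-filter-tabulate P? Q? {zero}  f g to from = refl
length-filter-tabulate P? Q? {suc k} f g to from
  with length-filter-tabulate P? Q? (f ∘ suc) (g ∘ suc) (to ∘ suc) (from ∘ suc) | P? (f zero) | Q? (g zero)
... | ih | yes _ | yes _ = cong suc ih
... | ih | yes p | no ¬q = contradiction (to zero p) ¬q
... | ih | no ¬p | yes q = contradiction (from zero q) ¬p
... | ih | no _  | no _  = ih

-- For `xs` with distinct letters and `s` decreasing of the same length, this is the word similar to
-- `xs` with letter set `s`.
arrange : List ℕ → List ℕ → List ℕ
arrange xs s = map (λ x → entry s (above x xs)) xs

sort-descending : ∀ {xs} → Unique xs → AllPairs _>_ (sort xs)
sort-descending {xs} xs! = AllPairs.zipWith (λ (y≤x , x≢y) → ≤∧≢⇒< y≤x (x≢y ∘ sym))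
  ( Sorted⇒AllPairs (≥-totalOrder ≤-totalOrder) (sort-↗ xs)
  , Unique-resp-↭ (↭⇒↭ₛ (↭-sym (sort-↭ xs))) xs!)

-- An order isomorphism preserves the number of larger entries, and that number locates an entry in
-- the sorted list. So a twin is recovered from the other twin and its own letter set, which is what
-- saves the factor `r !`.
arrange-sort : ∀ {k} (f g : Fin k → ℕ) → (∀ {i j} → g i ≡ g j → i ≡ j) →
               (∀ i j → f i < f j → g i < g j) → (∀ i j → g i < g j → f i < f j) →
               arrange (tabulate f) (sort (tabulate g)) ≡ tabulate g
arrange-sort f g g-inj to from = trans (map-tabulate f _) (tabulate-cong λ i →
  trans (cong (entry s) (trans (length-filter-tabulate (f i <?_) (g i <?_) f g (to i) (from i))
                               (sym (↭-length (filter-↭ (g i <?_) (sort-↭ (tabulate g)))))))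
        (entry-above (sort-descending (Unique.tabulate⁺ g-inj))
                     (∈-resp-↭ (↭-sym (sort-↭ (tabulate g))) (∈-tabulate⁺ i))))
  where s = sort (tabulate g)

-- Truncated when the list that the mask selects is exhausted.
merge : ∀ {A : Set} → List Bool → List A → List A → List A
merge []          xs       ys       = []
merge (true ∷ m)  []       ys       = []
merge (true ∷ m)  (x ∷ xs) ys       = x ∷ merge m xs ys
merge (false ∷ m) xs       []       = []
merge (false ∷ m) xs       (y ∷ ys) = y ∷ merge m xs ys

map-merge : ∀ {A B : Set} (f : A → B) m xs ys → map f (merge m xs ys) ≡ merge m (map f xs) (map f ys)
map-merge f []          xs       ys       = refl
map-merge f (true ∷ m)  []       ys       = refl
map-merge f (true ∷ m)  (x ∷ xs) ys       = cong (f x ∷_) (map-merge f m xs ys)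
map-merge f (false ∷ m) xs       []       = refl
map-merge f (false ∷ m) xs       (y ∷ ys) = cong (f y ∷_) (map-merge f m xs ys)

merge-swap : ∀ {A : Set} m (xs ys : List A) → merge (map not m) ys xs ≡ merge m xs ys
merge-swap []          xs       ys       = refl
merge-swap (true ∷ m)  []       ys       = refl
merge-swap (true ∷ m)  (x ∷ xs) ys       = cong (x ∷_) (merge-swap m xs ys)
merge-swap (false ∷ m) xs       []       = refl
merge-swap (false ∷ m) xs       (y ∷ ys) = cong (y ∷_) (merge-swap m xs ys)

bools : List Bool
bools = true ∷ false ∷ []

∈-bools : ∀ m → All (_∈ bools) m
∈-bools []          = []
∈-bools (true ∷ m)  = here refl ∷ ∈-bools m
∈-bools (false ∷ m) = there (here refl) ∷ ∈-bools m

-- The twins are interchangeable, so the first entry may be taken to belong to the first one.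
-- The resulting factor 1/2 is needed for the final estimate.
twinWords : ℕ → ℕ → List (List ℕ)
twinWords N r = cartesianProductWith (λ m (xs , s) → merge (true ∷ m) xs (arrange xs s))
                  (words (r + pred r) bools)
                  (cartesianProduct (words r (upTo N)) (descending r N))

∈-twinWords : ∀ {N k} (f g : Fin k → ℕ) m → suc (length m) ≡ k + k → (∀ i → f i < N) → (∀ i → g i < N) →
              (∀ {i j} → g i ≡ g j → i ≡ j) →
              (∀ i j → f i < f j → g i < g j) → (∀ i j → g i < g j → f i < f j) →
              merge (true ∷ m) (tabulate f) (tabulate g) ∈ twinWords N k
∈-twinWords {N} {k} f g m |m| f<N g<N g-inj to from =
  subst (λ ys → merge (true ∷ m) (tabulate f) ys ∈ twinWords N k) (arrange-sort f g g-inj to from)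
    (∈-cartesianProductWith⁺ _
      (subst (λ l → m ∈ words l bools) (trans (cong pred |m|) (pred-+ k)) (∈-words (∈-bools m)))
      (∈-cartesianProduct⁺
        (subst (λ l → tabulate f ∈ words l (upTo N)) (length-tabulate f)
          (∈-words (All.tabulate⁺ (∈-upTo⁺ ∘ f<N))))
        (subst (λ l → sort (tabulate g) ∈ descending l N)
          (trans (↭-length (sort-↭ (tabulate g))) (length-tabulate g))
          (∈-descending N (sort-descending (Unique.tabulate⁺ g-inj))
            (All-resp-↭ (↭-sym (sort-↭ (tabulate g))) (All.tabulate⁺ g<N))))))
  where
  pred-+ : ∀ k → pred (k + k) ≡ k + pred k
  pred-+ zero    = refl
  pred-+ (suc k) = +-suc k k

-- The factors count the free bits of the mask, the first twin, and the letter set of the second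
-- twin, of which there are at most N^r / r!.
!*length-twinWords : ∀ N r → r ! * length (twinWords N r) ≤ 2 ^ (r + pred r) * (N ^ r * N ^ r)
!*length-twinWords N r = begin
  r ! * length (twinWords N r)                 ≡⟨ cong (r ! *_) |twinWords| ⟩
  r ! * (2 ^ d * (N ^ r * c))                  ≡⟨ rearrange (r !) (2 ^ d) (N ^ r) c ⟩
  2 ^ d * (N ^ r * (r ! * c))                  ≤⟨ *-monoʳ-≤ (2 ^ d) (*-monoʳ-≤ (N ^ r) (!*length-descending r N)) ⟩
  2 ^ d * (N ^ r * N ^ r)                      ∎
  where
  open ≤-Reasoning
  d c : ℕ
  d = r + pred r
  c = length (descending r N)
  |twinWords| : length (twinWords N r) ≡ 2 ^ d * (N ^ r * c)
  |twinWords| =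
    trans (length-cartesianProductWith _ (words d bools) _)
      (cong₂ _*_ (length-words d bools)
        (trans (length-cartesianProductWith _,_ (words r (upTo N)) (descending r N))
          (cong (_* c) (trans (length-words r (upTo N)) (cong (_^ r) (length-upTo N))))))
  rearrange : ∀ a b c d → a * (b * (c * d)) ≡ b * (c * (a * d))
  rearrange = solve-∀

-- Good words

-- Words grow at the front from words already known to be good, so only repetitions of the new first
-- letter have to be excluded.
FreshHead : List ℕ → Set
FreshHead []       = ⊤
FreshHead (x ∷ xs) = x ∉ xs

freshHead? : Decidable FreshHead
freshHead? []       = yes tt
freshHead? (x ∷ xs) = ¬? (x ∈? xs)

module _ (N t : ℕ) where

  -- Only twins at the very front are tested, since later ones were excluded when the suffix was
  -- built; `j` counts lengths from the first forbidden one, `suc t`. The guard `r + r ≤ k` matters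
  -- because `take` returns less on a short word and `twinWords` can contain truncated merges.
  StartsWithTwins : ℕ → ℕ → List ℕ → Set
  StartsWithTwins k j w = let r = suc (t + j) in r + r ≤ k × take (r + r) w ∈ twinWords N r

  startsWithTwins? : ∀ k j → Decidable (StartsWithTwins k j)
  startsWithTwins? k j w = let r = suc (t + j) in r + r ≤? k ×-dec (take (r + r) w ∈ʷ? twinWords N r)

  Bad : ℕ → List ℕ → Set
  Bad k w = ¬ FreshHead w ⊎ Any (λ j → StartsWithTwins k j w) (upTo k)

  longTwins? : ∀ k → Decidable (λ w → Any (λ j → StartsWithTwins k j w) (upTo k))
  longTwins? k w = any? (λ j → startsWithTwins? k j w) (upTo k)

  bad? : ∀ k → Decidable (Bad k)
  bad? k w = ¬? (freshHead? w) ⊎-dec longTwins? k w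

  extensions : List (List ℕ) → List (List ℕ)
  extensions ws = cartesianProductWith _∷_ (upTo N) ws

  good : ℕ → List (List ℕ)
  good zero    = [] ∷ []
  good (suc k) = filter (¬? ∘ bad? (suc k)) (extensions (good k))

  ∷-∈-good⁻ : ∀ k {w} → w ∈ good (suc k) →
              ∃₂ λ x u → w ≡ x ∷ u × x < N × u ∈ good k × ¬ Bad (suc k) (x ∷ u)
  ∷-∈-good⁻ k w∈ with ∈-filter⁻ (¬? ∘ bad? (suc k)) {xs = extensions (good k)} w∈
  ... | w∈ext , ¬bad with ∈-cartesianProductWith⁻ _∷_ (upTo N) (good k) w∈ext
  ...   | x , u , x∈ , u∈ , refl = x , u , refl , ∈-upTo⁻ x∈ , u∈ , ¬bad

  length-∈-good : ∀ k {w} → w ∈ good k → length w ≡ k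
  length-∈-good zero    (here refl) = refl
  length-∈-good (suc k) w∈ with ∷-∈-good⁻ k w∈
  ... | x , u , refl , _ , u∈ , _ = cong suc (length-∈-good k u∈)

  unique-∈-good : ∀ k {w} → w ∈ good k → Unique w
  unique-∈-good zero    (here refl) = []
  unique-∈-good (suc k) w∈ with ∷-∈-good⁻ k w∈
  ... | x , u , refl , _ , u∈ , ¬bad = All.¬Any⇒All¬ u x∉u ∷ unique-∈-good k u∈
    where
    x∉u : x ∉ u
    x∉u x∈u = ¬bad (inj₁ λ x∉ → x∉ x∈u)

  all<-∈-good : ∀ k {w} → w ∈ good k → All (_< N) w
  all<-∈-good zero    (here refl) = []
  all<-∈-good (suc k) w∈ with ∷-∈-good⁻ k w∈
  ... | x , u , refl , x<N , u∈ , _ = x<N ∷ all<-∈-good k u∈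

  -- Words are built by prepending, so goodness passes to suffixes. This serves both to remove twins
  -- from the front and to bring twins that start at any index to the front.
  drop-∈-good : ∀ d k {w} → w ∈ good (d + k) → drop d w ∈ good k
  drop-∈-good zero    k w∈ = w∈
  drop-∈-good (suc d) k w∈ with ∷-∈-good⁻ (d + k) w∈
  ... | x , u , refl , _ , u∈ , _ = drop-∈-good d k u∈

  good-no-twins : ∀ k {w} j → w ∈ good k → ¬ StartsWithTwins k j w
  good-no-twins zero    j w∈ (() , _)
  good-no-twins (suc k) j w∈ st@(r+r≤k , _) with ∷-∈-good⁻ k w∈
  ... | x , u , refl , _ , _ , ¬bad =
    -- The guard `r + r ≤ suc k` forces `j < suc k`, so the search over `upTo (suc k)` misses no
    -- length.
    ¬bad (inj₂ (lose (∈-upTo⁺ (≤-trans (s≤s (≤-trans (m≤n+m j t) (m≤m+n (t + j) (suc (t + j))))) r+r≤k)) st))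

  extensions-! : ∀ ws → Unique ws → Unique (extensions ws)
  extensions-! ws ws! = Unique.cartesianProductWith⁺ _∷_ ∷-injective (Unique.upTo⁺ N) ws!

  good-! : ∀ k → Unique (good k)
  good-! zero    = [] ∷ []
  good-! (suc k) = Unique.filter⁺ (¬? ∘ bad? (suc k)) (extensions-! _ (good-! k))

  count : ℕ → ℕ
  count k = length (good k)

  -- The twins occupy the new letter and the first `d` letters of the old word. Behind them remains
  -- a good word of length `k`, and the two pieces determine the extension.
  startsWithTwins-count : ∀ k j → let d = (t + j) + suc (t + j) in
    length (filter (startsWithTwins? (suc (d + k)) j) (extensions (good (d + k)))) ≤
    length (twinWords N (suc (t + j))) * count k
  startsWithTwins-count k j =
    ≤-trans (length-⊆ (Unique.filter⁺ P? (extensions-! _ (good-! (d + k)))) split)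
            (≤-reflexive (length-cartesianProductWith _++_ (twinWords N r) (good k)))
    where
    d r : ℕ
    d = (t + j) + suc (t + j)
    r = suc (t + j)
    P? = startsWithTwins? (suc (d + k)) j
    split : filter P? (extensions (good (d + k))) ⊆ cartesianProductWith _++_ (twinWords N r) (good k)
    split w∈ with ∈-filter⁻ P? {xs = extensions (good (d + k))} w∈
    ... | w∈ext , _ , tw with ∈-cartesianProductWith⁻ _∷_ (upTo N) (good (d + k)) w∈ext
    ...   | x , u , _ , u∈ , refl =
      subst (_∈ cartesianProductWith _++_ (twinWords N r) (good k)) (take++drop≡id (r + r) (x ∷ u))
        (∈-cartesianProductWith⁺ _++_ tw
          (drop-∈-good d k u∈))

  -- A repeated first letter is determined by one of the `k` positions where it occurs again.
  repeat-count : ∀ k →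
    length (filter (λ w → ¬? (freshHead? w)) (extensions (good k))) ≤ k * count k
  repeat-count k =
    ≤-trans (length-⊆ (Unique.filter⁺ P? (extensions-! _ (good-! k))) repeats)
            (≤-reflexive (trans (length-cartesianProductWith repeat (upTo k) (good k))
                                (cong (_* count k) (length-upTo k))))
    where
    P? = λ w → ¬? (freshHead? w)
    repeat : ℕ → List ℕ → List ℕ
    repeat i u = entry u i ∷ u
    repeats : filter P? (extensions (good k)) ⊆ cartesianProductWith repeat (upTo k) (good k)
    repeats w∈ with ∈-filter⁻ P? {xs = extensions (good k)} w∈
    ... | w∈ext , ¬fresh with ∈-cartesianProductWith⁻ _∷_ (upTo N) (good k) w∈ext
    ...   | x , u , _ , u∈ , refl with ∈⇒entry (decidable-stable (x ∈? u) ¬fresh)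
    ...     | i , i<|u| , refl =
      ∈-cartesianProductWith⁺ repeat (∈-upTo⁺ (subst (i <_) (length-∈-good k u∈) i<|u|)) u∈

  twinCount : ℕ → ℕ → ℕ
  twinCount k j = length (filter (startsWithTwins? (suc k) j) (extensions (good k)))

  -- Union bound: an extension is good, repeats a letter, or starts with long twins of some length.
  extension-count : ∀ k →
    N * count k ≤ count (suc k) + (k * count k + sum (applyUpTo (twinCount k) (suc k)))
  extension-count k = begin
    N * count k
      ≡⟨ sym (trans (length-cartesianProductWith _∷_ (upTo N) (good k)) (cong (_* count k) (length-upTo N))) ⟩
    length ext
      ≤⟨ length-filter-∁ (bad? (suc k)) ext ⟩
    count (suc k) + length (filter (bad? (suc k)) ext)
      ≤⟨ +-monoʳ-≤ (count (suc k)) (length-filter-⊎ (bad? (suc k)) (λ w → ¬? (freshHead? w)) (longTwins? (suc k)) id ext) ⟩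
    count (suc k) + (length (filter (λ w → ¬? (freshHead? w)) ext) + length (filter (longTwins? (suc k)) ext))
      ≤⟨ +-monoʳ-≤ (count (suc k)) (+-mono-≤ (repeat-count k)
           (length-filter-Any (startsWithTwins? (suc k)) (upTo (suc k)) ext)) ⟩
    count (suc k) + (k * count k + sum (map (twinCount k) (upTo (suc k))))
      ≡⟨ cong (λ l → count (suc k) + (k * count k + sum l)) (map-upTo (twinCount k) (suc k)) ⟩
    count (suc k) + (k * count k + sum (applyUpTo (twinCount k) (suc k))) ∎
    where
    open ≤-Reasoning
    ext = extensions (good k)

-- Geometric sums and factorial estimates

-- The tail of the sequence satisfies the same hypothesis with `2 * c` in place of `c`, so its sum
-- is at most M / c, as is `b 0`.
sum-geometric : ∀ c M (b : ℕ → ℕ) m → (∀ j → c * 2 ^ j * b j ≤ M) → c * sum (applyUpTo b m) ≤ 2 * M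
sum-geometric c M b zero    b≤ = ≤-trans (≤-reflexive (*-zeroʳ c)) z≤n
sum-geometric c M b (suc m) b≤ = begin
  c * (b 0 + s)     ≡⟨ *-distribˡ-+ c (b 0) s ⟩
  c * b 0 + c * s   ≤⟨ +-mono-≤ (subst (λ x → x * b 0 ≤ M) (*-identityʳ c) (b≤ 0)) (*-cancelˡ-≤ 2 2cs≤2M) ⟩
  M + M             ≡⟨ cong (M +_) (sym (+-identityʳ M)) ⟩
  2 * M             ∎
  where
  open ≤-Reasoning
  s = sum (applyUpTo (b ∘ suc) m)
  2cs≤2M : 2 * (c * s) ≤ 2 * M
  2cs≤2M = subst (_≤ 2 * M) (*-assoc 2 c s)
    (sum-geometric (2 * c) M (b ∘ suc) m λ j →
      subst (λ x → x * b (suc j) ≤ M) (trans (sym (*-assoc c 2 (2 ^ j))) (cong (_* 2 ^ j) (*-comm c 2))) (b≤ (suc j)))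

factorial-growth-step : ∀ c x y j e m → 2 * (x * x) ≤ suc m * (y * y) →
                        c * 2 ^ j * x ^ e ≤ m ! * y ^ e →
                        c * 2 ^ suc j * x ^ (2 + e) ≤ suc m ! * y ^ (2 + e)
factorial-growth-step c x y j e m 2x²≤ ih = begin
  c * (2 * 2 ^ j) * (x * (x * x ^ e))   ≡⟨ lhs c (2 ^ j) x (x ^ e) ⟩
  2 * (x * x) * (c * 2 ^ j * x ^ e)     ≤⟨ *-mono-≤ 2x²≤ ih ⟩
  suc m * (y * y) * (m ! * y ^ e)       ≡⟨ rhs (suc m) y (m !) (y ^ e) ⟩
  suc m * m ! * (y * (y * y ^ e))       ∎
  where
  open ≤-Reasoning
  lhs : ∀ c t x p → c * (2 * t) * (x * (x * p)) ≡ 2 * (x * x) * (c * t * p)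
  lhs = solve-∀
  rhs : ∀ r y f q → r * (y * y) * (f * q) ≡ r * f * (y * (y * q))
  rhs = solve-∀

-- Raising `j` by one multiplies the left side by `2 * (x * x)` and the right side by `y * y` times
-- a new factor of the factorial, which is at least `2 + t`. Thus one numerical case and one ratio
-- control all twin lengths.
factorial-growth : ∀ c x y t → c * x ^ (t + suc t) ≤ suc t ! * y ^ (t + suc t) →
                   2 * (x * x) ≤ (2 + t) * (y * y) →
                   ∀ j → c * 2 ^ j * x ^ ((t + j) + suc (t + j)) ≤ suc (t + j) ! * y ^ ((t + j) + suc (t + j))
factorial-growth c x y t base ratio zero
  rewrite *-identityʳ c | +-identityʳ t = base
factorial-growth c x y t base ratio (suc j) =
  subst₂ (λ e m → c * 2 ^ suc j * x ^ e ≤ suc m ! * y ^ e) (exponent t j) (sym (+-suc t j))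
    (factorial-growth-step c x y j ((t + j) + suc (t + j)) (suc (t + j))
      (≤-trans ratio (*-monoˡ-≤ (y * y) (s≤s (s≤s (m≤m+n t j)))))
      (factorial-growth c x y t base ratio j))
  where
  exponent : ∀ t j → 2 + ((t + j) + suc (t + j)) ≡ (t + suc j) + suc (t + suc j)
  exponent = solve-∀

^-distribʳ-* : ∀ k m n → (m * n) ^ k ≡ m ^ k * n ^ k
^-distribʳ-* zero    m n = refl
^-distribʳ-* (suc k) m n = trans (cong (m * n *_) (^-distribʳ-* k m n)) (rearrange m n (m ^ k) (n ^ k))
  where
  rearrange : ∀ a b c d → a * b * (c * d) ≡ a * c * (b * d)
  rearrange = solve-∀

-- Growth of the number of good words

module _ (N t p q : ℕ) where

  -- The inequality c(k + 1) ≥ (q / p) N c(k), cleared of denominators.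
  Growth : ℕ → Set
  Growth k = q * N * count N t k ≤ p * count N t (suc k)

  iterate-growth : ∀ d k → (∀ {i} → i < d + k → Growth i) →
                   (q * N) ^ d * count N t k ≤ p ^ d * count N t (d + k)
  iterate-growth zero    k grow = ≤-refl
  iterate-growth (suc d) k grow =
    step (q * N) p ((q * N) ^ d) (p ^ d) _ _ _ (iterate-growth d k (grow ∘ m<n⇒m<1+n)) (grow (n<1+n (d + k)))
    where
    step : ∀ a b aᵈ bᵈ x y z → aᵈ * x ≤ bᵈ * y → a * y ≤ b * z → a * aᵈ * x ≤ b * bᵈ * z
    step a b aᵈ bᵈ x y z h₁ h₂ = begin
      a * aᵈ * x     ≡⟨ *-assoc a aᵈ x ⟩
      a * (aᵈ * x)   ≤⟨ *-monoʳ-≤ a h₁ ⟩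
      a * (bᵈ * y)   ≡⟨ rearrange a bᵈ y ⟩
      bᵈ * (a * y)   ≤⟨ *-monoʳ-≤ bᵈ h₂ ⟩
      bᵈ * (b * z)   ≡⟨ rearrange′ bᵈ b z ⟩
      b * bᵈ * z     ∎
      where
      open ≤-Reasoning
      rearrange : ∀ a b c → a * (b * c) ≡ b * (a * c)
      rearrange = solve-∀
      rearrange′ : ∀ a b c → a * (b * c) ≡ b * a * c
      rearrange′ = solve-∀

-- For twins of length r, `f` is r!, `d` is 2r - 1, `T` counts the twin words, `b` the extensions
-- starting with them, and `g′` and `g` the good words after and before the removal of `d` letters.
-- The growth over `d` steps cancels all but one of the `N * N ^ d` in the bound for `T`.
cancel-growth : ∀ N p q d c f b T g g′ .{{_ : NonZero (f * q ^ d)}} →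
                b ≤ T * g′ → f * T ≤ 2 ^ d * (N * N ^ d) → (q * N) ^ d * g′ ≤ p ^ d * g →
                c * (2 * p) ^ d ≤ f * q ^ d → c * b ≤ N * g
cancel-growth N p q d c f b T g g′ b≤ fT≤ g′≤ c≤ = *-cancelˡ-≤ (f * q ^ d) (begin
  f * q ^ d * (c * b)                       ≤⟨ *-monoʳ-≤ (f * q ^ d) (*-monoʳ-≤ c b≤) ⟩
  f * q ^ d * (c * (T * g′))                ≡⟨ eq₁ f (q ^ d) c T g′ ⟩
  c * (f * T) * (q ^ d * g′)                ≤⟨ *-monoˡ-≤ (q ^ d * g′) (*-monoʳ-≤ c fT≤) ⟩
  c * (2 ^ d * (N * N ^ d)) * (q ^ d * g′)  ≡⟨ eq₂ c (2 ^ d) N (N ^ d) (q ^ d) g′ ⟩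
  c * 2 ^ d * N * (q ^ d * N ^ d * g′)      ≡⟨ cong (λ x → c * 2 ^ d * N * (x * g′)) (sym (^-distribʳ-* d q N)) ⟩
  c * 2 ^ d * N * ((q * N) ^ d * g′)        ≤⟨ *-monoʳ-≤ (c * 2 ^ d * N) g′≤ ⟩
  c * 2 ^ d * N * (p ^ d * g)               ≡⟨ eq₃ c (2 ^ d) N (p ^ d) g ⟩
  c * (2 ^ d * p ^ d) * (N * g)             ≡⟨ cong (λ x → c * x * (N * g)) (sym (^-distribʳ-* d 2 p)) ⟩
  c * (2 * p) ^ d * (N * g)                 ≤⟨ *-monoˡ-≤ (N * g) c≤ ⟩
  f * q ^ d * (N * g)                       ∎)
  where
  open ≤-Reasoning
  eq₁ : ∀ f q c t g → f * q * (c * (t * g)) ≡ c * (f * t) * (q * g)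
  eq₁ = solve-∀
  eq₂ : ∀ c a n m q g → c * (a * (n * m)) * (q * g) ≡ c * a * n * (q * m * g)
  eq₂ = solve-∀
  eq₃ : ∀ c a n p g → c * a * n * (p * g) ≡ c * (a * p) * (n * g)
  eq₃ = solve-∀

-- Losing X / (m s) to K and X / s to S leaves the fraction q / p of X, as 1 - (m + 1) / (m s) = q / p.
combine-growth : ∀ m s p q X g K S → m * s ≡ 2 * p → m * s ≡ 2 * q + suc m →
                 X ≤ g + (K + S) → m * s * K ≤ X → s * S ≤ X → q * X ≤ p * g
combine-growth m s p q X g K S ms≡2p ms≡2q+m+1 X≤ K≤ S≤ =
  *-cancelˡ-≤ 2 (+-cancelʳ-≤ (suc m * X) _ _ (begin
    2 * (q * X) + suc m * X                   ≡⟨ eq₁ q m X ⟩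
    (2 * q + suc m) * X                       ≡⟨ cong (_* X) (sym ms≡2q+m+1) ⟩
    m * s * X                                 ≤⟨ *-monoʳ-≤ (m * s) X≤ ⟩
    m * s * (g + (K + S))                     ≡⟨ eq₂ m s g K S ⟩
    m * s * g + (m * s * K + m * (s * S))     ≤⟨ +-monoʳ-≤ (m * s * g) (+-mono-≤ K≤ (*-monoʳ-≤ m S≤)) ⟩
    m * s * g + suc m * X                     ≡⟨ cong (λ x → x * g + suc m * X) ms≡2p ⟩
    2 * p * g + suc m * X                     ≡⟨ cong (_+ suc m * X) (*-assoc 2 p g) ⟩
    2 * (p * g) + suc m * X                   ∎))
  where
  open ≤-Reasoning
  eq₁ : ∀ q m X → 2 * (q * X) + suc m * X ≡ (2 * q + suc m) * X
  eq₁ = solve-∀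
  eq₂ : ∀ m s g K S → m * s * (g + (K + S)) ≡ m * s * g + (m * s * K + m * (s * S))
  eq₂ = solve-∀

module _ (N t p q s : ℕ) .{{_ : NonZero q}}
         (factorial : ∀ j → 2 * s * 2 ^ j * (2 * p) ^ ((t + j) + suc (t + j)) ≤ suc (t + j) ! * q ^ ((t + j) + suc (t + j))) where

  twinCount-bound : ∀ k → (∀ {i} → i < k → Growth N t p q i) →
                    ∀ j → 2 * s * 2 ^ j * twinCount N t k j ≤ N * count N t k
  twinCount-bound k grow j = bound (suc (t + j) + suc (t + j) ≤? suc k)
    where
    d : ℕ
    d = (t + j) + suc (t + j)
    Bound : ℕ → Set
    Bound k = 2 * s * 2 ^ j * twinCount N t k j ≤ N * count N t k
    bound-+ : ∀ k′ → (∀ {i} → i < d + k′ → Growth N t p q i) → Bound (d + k′)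
    bound-+ k′ grow = cancel-growth N p q d (2 * s * 2 ^ j) (suc (t + j) !)
      (twinCount N t (d + k′) j) (length (twinWords N (suc (t + j)))) (count N t (d + k′)) (count N t k′)
      {{m*n≢0 (suc (t + j) !) (q ^ d) {{suc (t + j) !≢0}} {{m^n≢0 q d}}}}
      (startsWithTwins-count N t k′ j)
      (subst₂ (λ x y → suc (t + j) ! * length (twinWords N (suc (t + j))) ≤ 2 ^ x * y) (sym (+-suc (t + j) (t + j)))
        (sym (^-distribˡ-+-* N (suc (t + j)) (suc (t + j))))
        (!*length-twinWords N (suc (t + j))))
      (iterate-growth N t p q d k′ grow)
      (factorial j)
    bound-≡ : ∀ {k′} → k ≡ d + k′ → Bound k
    bound-≡ refl = bound-+ _ grow
    bound : Dec (suc (t + j) + suc (t + j) ≤ suc k) → Bound k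
    bound (yes r+r≤k) = let k′ , eq = m≤n⇒∃[o]m+o≡n r+r≤k in
      bound-≡ (suc-injective (sym eq))
    bound (no r+r≰k)  =
      -- A word of length `suc k` is too short to start with these twins, so the count is zero.
      ≤-trans (≤-reflexive (trans (cong (2 * s * 2 ^ j *_) (cong length
                (filter-none (startsWithTwins? N t (suc k) j) (All.universal (λ _ → r+r≰k ∘ proj₁) (extensions N t (good N t k))))))
                (*-zeroʳ (2 * s * 2 ^ j)))) z≤n

  -- Strong induction, because removing twins leads back over many lengths at once. Repetitions cost
  -- at most the fraction 1 / (m s) of the extensions, as `k < n` and `m * s * n ≤ N`.
  growth : ∀ m n → m * s ≡ 2 * p → m * s ≡ 2 * q + suc m → m * s * n ≤ N → ∀ k → k < n → Growth N t p q k
  growth m n ms≡2p ms≡2q+m+1 msn≤N = <-rec _ λ k grow k<n →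
    ≤-trans (≤-reflexive (*-assoc q N (count N t k)))
      (combine-growth m s p q (N * count N t k) (count N t (suc k)) (k * count N t k) (twins k) ms≡2p ms≡2q+m+1
        (extension-count N t k)
        (≤-trans (≤-reflexive (sym (*-assoc (m * s) k (count N t k))))
          (*-monoˡ-≤ (count N t k) (≤-trans (*-monoʳ-≤ (m * s) (<⇒≤ k<n)) msn≤N)))
        -- The 2 in `2 * s` absorbs the factor 2 of the geometric series, so that twins of all
        -- lengths together cost at most 1 / s.
        (*-cancelˡ-≤ 2 (≤-trans (≤-reflexive (sym (*-assoc 2 s (twins k))))
          (sum-geometric (2 * s) (N * count N t k) (twinCount N t k) (suc k)
            (twinCount-bound k (λ i<k → grow i<k (<-trans i<k k<n)))))))
    where
    twins : ℕ → ℕ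
    twins k = sum (applyUpTo (twinCount N t k) (suc k))

nonempty : ∀ {A : Set} {xs : List A} → 0 < length xs → ∃[ x ] x ∈ xs
nonempty {xs = x ∷ xs} _ = x , here refl

-- Growth iterated from the empty word gives (q N)^n ≤ p^n c(n), so c(n) cannot vanish.
good-nonempty : ∀ N t p q n → .{{NonZero (q * N)}} → (∀ k → k < n → Growth N t p q k) → ∃[ w ] w ∈ good N t n
good-nonempty N t p q n grow = nonempty (n≢0⇒n>0 λ count≡0 → <⇒≱ (m^n>0 (q * N) n)
  (subst₂ _≤_ (*-identityʳ ((q * N) ^ n))
    (trans (cong (λ m → p ^ n * count N t m) (+-identityʳ n))
           (trans (cong (p ^ n *_) count≡0) (*-zeroʳ (p ^ n))))
    (iterate-growth N t p q n 0 λ {i} i<n → grow i (subst (i <_) (+-identityʳ n) i<n))))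

good-exists : ∀ n → 1 ≤ n → ∃[ N ] ∃[ w ] w ∈ good N 12 n
good-exists n@(suc _) _ = N , good-nonempty N 12 100 97 n {{m*n≢0 97 N {{_}} {{m*n≢0 (5 * 40) n}}}}
  -- Losing 1 / 40 to twins and 1 / 200 to repeated letters leaves exactly 97 / 100.
  (growth N 12 100 97 40
    (factorial-growth (2 * 40) (2 * 100) 97 12
      -- The shortest forbidden twins, of length 13, are the critical case: 80 (200 / 97)^25 ≤ 13!.
      -- With the same constants the analogue for length 12 fails.
      (≤ᵇ⇒≤ (2 * 40 * (2 * 100) ^ (12 + 13)) (13 ! * 97 ^ (12 + 13)) tt)
      (≤ᵇ⇒≤ (2 * (2 * 100 * (2 * 100))) (14 * (97 * 97)) tt))
    5 n refl refl ≤-refl)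
  where
  N : ℕ
  N = 5 * 40 * n

-- From good words to permutations

-- Surjectivity by counting: a missed value together with the n values taken would be n + 1 elements of Fin n.
injective⇒permutation : ∀ {n} (f : Fin n → Fin n) → (∀ {i j} → f i ≡ f j → i ≡ j) →
                        ∃[ π ] ∀ i → π ⟨$⟩ʳ i ≡ f i
injective⇒permutation {n} f f-inj =
  permutation f (proj₁ ∘ surjective) (proj₂ ∘ surjective) (λ i → f-inj (proj₂ (surjective (f i)))) , λ _ → refl
  where
  surjective : ∀ y → ∃[ i ] f i ≡ y
  surjective y with Fin.any? (λ i → f i Fin.≟ y)
  ... | yes hit = hit
  ... | no miss = contradiction
    (subst₂ _≤_ (cong suc (length-tabulate f)) (length-tabulate {n = n} id)
      (length-⊆ (All.tabulate⁺ (λ i y≡fi → miss (i , sym y≡fi)) ∷ Unique.tabulate⁺ f-inj) (λ {x} _ → ∈-allFin x)))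
    1+n≰n

-- Each value is replaced by its rank, the number of smaller values, which is less than `n` and
-- keeps the order.
standardize : ∀ {n} (v : Fin n → ℕ) → (∀ {i j} → v i ≡ v j → i ≡ j) →
              ∃[ π ] (∀ i j → v i < v j → toℕ (π ⟨$⟩ʳ i) < toℕ (π ⟨$⟩ʳ j)) ×
                     (∀ i j → toℕ (π ⟨$⟩ʳ i) < toℕ (π ⟨$⟩ʳ j) → v i < v j)
standardize {n} v v-inj =
  let π , π≡ = injective⇒permutation (λ i → fromℕ< (rank<n i)) (rank-injective ∘ Fin.fromℕ<-injective _ _ _ _)
      toℕπ i = trans (cong toℕ (π≡ i)) (Fin.toℕ-fromℕ< (rank<n i))
  in π , (λ i j vi<vj → subst₂ _<_ (sym (toℕπ i)) (sym (toℕπ j)) (rank-mono vi<vj))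
       , (λ i j πi<πj → rank-cancel (subst₂ _<_ (toℕπ i) (toℕπ j) πi<πj))
  where
  rank : Fin n → ℕ
  rank i = length (filter (_<? v i) (tabulate v))

  rank<n : ∀ i → rank i < n
  rank<n i = subst (rank i <_) (length-tabulate v)
    (filter-notAll (_<? v i) (tabulate v) (lose (∈-tabulate⁺ i) (<-irrefl refl)))

  rank-mono : ∀ {i j} → v i < v j → rank i < rank j
  -- The values below `v i`, together with `v i` itself, are distinct values below `v j`.
  rank-mono {i} {j} vi<vj = length-⊆
    (All.map (λ x<vi vi≡x → <-irrefl (sym vi≡x) x<vi) (All.all-filter (_<? v i) (tabulate v))
      ∷ Unique.filter⁺ (_<? v i) (Unique.tabulate⁺ v-inj))
    λ { (here refl) → ∈-filter⁺ (_<? v j) (∈-tabulate⁺ i) vi<vj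
      ; (there x∈)  → let x∈v , x<vi = ∈-filter⁻ (_<? v i) {xs = tabulate v} x∈ in ∈-filter⁺ (_<? v j) x∈v (<-trans x<vi vi<vj) }

  rank-cancel : ∀ {i j} → rank i < rank j → v i < v j
  rank-cancel {i} {j} ri<rj with <-cmp (v i) (v j)
  ... | tri< vi<vj _ _ = vi<vj
  ... | tri≈ _ vi≡vj _ = contradiction (cong rank (v-inj vi≡vj)) (<⇒≢ ri<rj)
  ... | tri> _ _ vi>vj = contradiction (rank-mono vi>vj) (<⇒≯ ri<rj)

  rank-injective : ∀ {i j} → rank i ≡ rank j → i ≡ j
  rank-injective {i} {j} ri≡rj with <-cmp (v i) (v j)
  ... | tri< vi<vj _ _ = contradiction ri≡rj (<⇒≢ (rank-mono vi<vj))
  ... | tri≈ _ vi≡vj _ = v-inj vi≡vj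
  ... | tri> _ _ vi>vj = contradiction (sym ri≡rj) (<⇒≢ (rank-mono vi>vj))

-- Tight twins as merges of consecutive indices

record Tiles (c l : ℕ) (xs ys : List ℕ) : Set where
  field
    sortedˡ  : AllPairs _<_ xs
    sortedʳ  : AllPairs _<_ ys
    disjoint : ∀ {x} → x ∈ xs → x ∉ ys
    boundedˡ : ∀ {x} → x ∈ xs → c ≤ x × x < l + c
    boundedʳ : ∀ {x} → x ∈ ys → c ≤ x × x < l + c
    cover    : ∀ {x} → c ≤ x → x < l + c → x ∈ xs ⊎ x ∈ ys

Tiles-swap : ∀ {c l xs ys} → Tiles c l xs ys → Tiles c l ys xs
Tiles-swap T = record
  { sortedˡ  = sortedʳ
  ; sortedʳ  = sortedˡ
  ; disjoint = flip disjoint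
  ; boundedˡ = boundedʳ
  ; boundedʳ = boundedˡ
  ; cover    = λ c≤x x<l+c → [ inj₂ , inj₁ ]′ (cover c≤x x<l+c)
  }
  where open Tiles T

-- As the least element of the interval, `c` can only be the head of the increasing list that holds
-- it.
Tiles-uncons : ∀ {c l xs ys} → Tiles c (suc l) xs ys → c ∈ xs →
               ∃[ xs′ ] xs ≡ c ∷ xs′ × Tiles (suc c) l xs′ ys
Tiles-uncons {xs = x ∷ xs} T (there c∈xs) = contradiction (All.lookup x<xs c∈xs) (≤⇒≯ (proj₁ (boundedˡ (here refl))))
  where
  open Tiles T
  x<xs : All (x <_) xs
  x<xs = AllPairs.head sortedˡ
Tiles-uncons {c} {l} {.c ∷ xs} {ys} T (here refl) = xs , refl , record
  { sortedˡ  = AllPairs.tail sortedˡ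
  ; sortedʳ  = sortedʳ
  ; disjoint = disjoint ∘ there
  ; boundedˡ = λ x∈ → All.lookup (AllPairs.head sortedˡ) x∈ , shift-< (proj₂ (boundedˡ (there x∈)))
  ; boundedʳ = λ x∈ → ≤∧≢⇒< (proj₁ (boundedʳ x∈)) (λ { refl → disjoint (here refl) x∈ })
                    , shift-< (proj₂ (boundedʳ x∈))
  ; cover    = λ {x} c<x x< → drop-head c<x (cover (<⇒≤ c<x) (subst (x <_) (+-suc l c) x<))
  }
  where
  open Tiles T
  shift-< : ∀ {x} → x < suc l + c → x < l + suc c
  shift-< {x} = subst (x <_) (sym (+-suc l c))
  drop-head : ∀ {x} → c < x → x ∈ c ∷ xs ⊎ x ∈ ys → x ∈ xs ⊎ x ∈ ys
  drop-head c<x (inj₁ (here refl)) = contradiction c<x (<-irrefl refl)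
  drop-head c<x (inj₁ (there x∈))  = inj₁ x∈
  drop-head c<x (inj₂ x∈)          = inj₂ x∈

-- The mask records, index by index from `c` on, which of the two lists contains the index.
Tiles⇒merge : ∀ l {c xs ys} → Tiles c l xs ys →
              ∃[ m ] length m ≡ l × length xs + length ys ≡ l × merge m xs ys ≡ iterate suc c l
Tiles⇒merge zero {c} {xs} {ys} T with xs | ys
... | []    | []    = [] , refl , refl , refl
... | x ∷ _ | _     = let c≤x , x<c = Tiles.boundedˡ T (here refl) in contradiction x<c (≤⇒≯ c≤x)
... | []    | y ∷ _ = let c≤y , y<c = Tiles.boundedʳ T (here refl) in contradiction y<c (≤⇒≯ c≤y)
Tiles⇒merge (suc l) {c} {xs} {ys} T with Tiles.cover T ≤-refl (s≤s (m≤n+m c l))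
... | inj₁ c∈xs with Tiles-uncons T c∈xs
...   | xs′ , refl , T′ with Tiles⇒merge l T′
...     | m , |m| , |xs|+|ys| , eq = true ∷ m , cong suc |m| , cong suc |xs|+|ys| , cong (c ∷_) eq
Tiles⇒merge (suc l) {c} {xs} {ys} T | inj₂ c∈ys with Tiles-uncons (Tiles-swap T) c∈ys
...   | ys′ , refl , T′ with Tiles⇒merge l (Tiles-swap T′)
...     | m , |m| , |xs|+|ys| , eq =
  false ∷ m , cong suc |m| , trans (+-suc (length xs) (length ys′)) (cong suc |xs|+|ys|) , cong (c ∷_) eq

drop-entry : ∀ {c} xs → c < length xs → drop c xs ≡ entry xs c ∷ drop (suc c) xs
drop-entry {zero}  (x ∷ xs) _         = refl
drop-entry {suc c} (x ∷ xs) (s<s c<n) = drop-entry xs c<n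

map-entry-iterate : ∀ l c xs → l + c ≤ length xs → map (entry xs) (iterate suc c l) ≡ take l (drop c xs)
map-entry-iterate zero    c xs _ = refl
map-entry-iterate (suc l) c xs l+c<n =
  trans (cong (entry xs c ∷_) (map-entry-iterate l (suc c) xs (subst (_≤ length xs) (sym (+-suc l c)) l+c<n)))
        (cong (take (suc l)) (sym (drop-entry xs (<-≤-trans (s≤s (m≤n+m c l)) l+c<n))))

-- Similarity compares only pairs of positions in increasing order; for the reversed pairs,
-- distinctness of the values turns a failed comparison into the opposite one.
order-iso : ∀ {k} (u v : Fin k → ℕ) → (∀ {i j} → v i ≡ v j → i ≡ j) →
            (∀ i j → toℕ i < toℕ j → u i < u j → v i < v j) →
            (∀ i j → toℕ i < toℕ j → v i < v j → u i < u j) →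
            ∀ i j → u i < u j → v i < v j
order-iso u v v-inj to from i j ui<uj with Fin.<-cmp i j
... | tri< i<j _ _  = to i j i<j ui<uj
... | tri≈ _ refl _ = contradiction ui<uj (<-irrefl refl)
... | tri> _ i≢j j<i with <-cmp (v i) (v j)
...   | tri< vi<vj _ _ = vi<vj
...   | tri≈ _ vi≡vj _ = contradiction (v-inj vi≡vj) i≢j
...   | tri> _ _ vj<vi = contradiction (from j i j<i vj<vi) (<⇒≯ ui<uj)

-- If the first entry belongs to the second twin, the twins exchange roles and the mask is negated.
merge-∈-twinWords : ∀ {N k} (u v : Fin k → ℕ) m → 0 < k → length m ≡ k + k →
                    (∀ i → u i < N) → (∀ i → v i < N) →
                    (∀ {i j} → u i ≡ u j → i ≡ j) → (∀ {i j} → v i ≡ v j → i ≡ j) →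
                    (∀ i j → u i < u j → v i < v j) → (∀ i j → v i < v j → u i < u j) →
                    merge m (tabulate u) (tabulate v) ∈ twinWords N k
merge-∈-twinWords {k = suc k} u v [] _ ()
merge-∈-twinWords u v (true ∷ m) _ |m| u<N v<N u-inj v-inj to from =
  ∈-twinWords u v m |m| u<N v<N v-inj to from
merge-∈-twinWords {N} {k} u v (false ∷ m) _ |m| u<N v<N u-inj v-inj to from =
  subst (_∈ twinWords N k) (merge-swap (false ∷ m) (tabulate u) (tabulate v))
    (∈-twinWords v u (map not m) (trans (cong suc (length-map not m)) |m|) v<N u<N u-inj from to)

increasing-injective : ∀ {k n} {h : Fin k → Fin n} → StrictlyIncreasing h → ∀ {i j} → h i ≡ h j → i ≡ j
increasing-injective h↗ {i} {j} eq with Fin.<-cmp i j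
... | tri< i<j _ _ = contradiction (cong toℕ eq) (<⇒≢ (h↗ i j i<j))
... | tri≈ _ i≡j _ = i≡j
... | tri> _ _ j<i = contradiction (cong toℕ (sym eq)) (<⇒≢ (h↗ j i j<i))

-- The index sets of tight twins tile an interval. With `0 < k` that interval contains an index,
-- which places its start `a` within the word.
segment⇒merge : ∀ {k n} (f g : Fin k → Fin n) → 0 < k → StrictlyIncreasing f → StrictlyIncreasing g →
                Disjoint f g → IsSegmentUnion f g →
                ∃[ a ] ∃[ m ] a ≤ n × k + k ≤ n ∸ a × length m ≡ k + k ×
                  merge m (tabulate (toℕ ∘ f)) (tabulate (toℕ ∘ g)) ≡ iterate suc a (k + k)
segment⇒merge {k@(suc _)} {n} f g _ f↗ g↗ f#g (a , b , seg) =
  let m , |m| , |f|+|g| , eq = Tiles⇒merge (e ∸ a) tiles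
      k+k≡ = trans (sym (cong₂ _+_ (length-tabulate (toℕ ∘ f)) (length-tabulate (toℕ ∘ g)))) |f|+|g|
  in a , m , ≤-trans a≤e (m⊓n≤n (suc b) n)
   , ≤-trans (≤-reflexive k+k≡) (∸-monoˡ-≤ a (m⊓n≤n (suc b) n))
   , trans |m| (sym k+k≡) , trans eq (cong (iterate suc a) (sym k+k≡))
  where
  -- IsSegmentUnion does not require b < n.
  e : ℕ
  e = suc b ⊓ n

  in-segment : ∀ x → InUnion f g x → a ≤ toℕ x × toℕ x < e
  in-segment x x∈ = let a≤x , x≤b = Equivalence.from (seg x) x∈ in a≤x , ⊓-glb (s≤s x≤b) (Fin.toℕ<n x)

  a≤e : a ≤ e
  a≤e = let a≤x , x<e = in-segment (f zero) (inj₁ (zero , refl)) in ≤-trans a≤x (<⇒≤ x<e)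

  e≡ : (e ∸ a) + a ≡ e
  e≡ = m∸n+n≡m a≤e

  bounded : ∀ (h : Fin k → Fin n) → (∀ i → InUnion f g (h i)) →
            ∀ {x} → x ∈ tabulate (toℕ ∘ h) → a ≤ x × x < (e ∸ a) + a
  bounded h h∈ {x} x∈ with ∈-tabulate⁻ {f = toℕ ∘ h} x∈
  ... | i , refl = let a≤x , x<e = in-segment (h i) (h∈ i) in a≤x , subst (x <_) (sym e≡) x<e

  covered : ∀ {x} → a ≤ x → x < (e ∸ a) + a → x ∈ tabulate (toℕ ∘ f) ⊎ x ∈ tabulate (toℕ ∘ g)
  covered {x} a≤x x< = locate (Equivalence.to (seg y)
      (subst (a ≤_) (sym toℕy≡x) a≤x , subst (_≤ b) (sym toℕy≡x) (s≤s⁻¹ (<-≤-trans x<e (m⊓n≤m (suc b) n)))))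
    where
    x<e : x < e
    x<e = subst (x <_) e≡ x<
    y : Fin n
    y = fromℕ< (<-≤-trans x<e (m⊓n≤n (suc b) n))
    toℕy≡x : toℕ y ≡ x
    toℕy≡x = Fin.toℕ-fromℕ< _
    hit : ∀ (h : Fin k → Fin n) i → h i ≡ y → x ∈ tabulate (toℕ ∘ h)
    hit h i eq = subst (_∈ tabulate (toℕ ∘ h)) (trans (cong toℕ eq) toℕy≡x) (∈-tabulate⁺ {f = toℕ ∘ h} i)
    locate : InUnion f g y → x ∈ tabulate (toℕ ∘ f) ⊎ x ∈ tabulate (toℕ ∘ g)
    locate (inj₁ (i , eq)) = inj₁ (hit f i eq)
    locate (inj₂ (i , eq)) = inj₂ (hit g i eq)

  tiles : Tiles a (e ∸ a) (tabulate (toℕ ∘ f)) (tabulate (toℕ ∘ g))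
  tiles = record
    { sortedˡ  = AllPairs.tabulate⁺-< (f↗ _ _)
    ; sortedʳ  = AllPairs.tabulate⁺-< (g↗ _ _)
    ; disjoint = λ x∈f x∈g →
        let i , x≡fi = ∈-tabulate⁻ {f = toℕ ∘ f} x∈f
            j , x≡gj = ∈-tabulate⁻ {f = toℕ ∘ g} x∈g
        in f#g i j (Fin.toℕ-injective (trans (sym x≡fi) x≡gj))
    ; boundedˡ = bounded f (λ i → inj₁ (i , refl))
    ; boundedʳ = bounded g (λ i → inj₂ (i , refl))
    ; cover    = covered
    }

-- The permutation is the standardization of `w`. Tight twins longer than `t` whose segment starts
-- at `a` would stand at the front of `drop a w`, which is again good.
good⇒ttNAtMost : ∀ {N t n w} → w ∈ good N t n → ttNAtMost n t
good⇒ttNAtMost {N} {t} {n} {w} w∈ = π , λ k f g twins → ≮⇒≥ (no-twins f g twins)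
  where
  |w| : length w ≡ n
  |w| = length-∈-good N t n w∈

  v : Fin n → ℕ
  v i = entry w (toℕ i)

  toℕ<|w| : ∀ i → toℕ i < length w
  toℕ<|w| i = subst (toℕ i <_) (sym |w|) (Fin.toℕ<n i)

  v-inj : ∀ {i j} → v i ≡ v j → i ≡ j
  v-inj {i} {j} eq = Fin.toℕ-injective (entry-injective (unique-∈-good N t n w∈) (toℕ<|w| i) (toℕ<|w| j) eq)

  v<N : ∀ i → v i < N
  v<N i = All.lookup (all<-∈-good N t n w∈) (entry-∈ (toℕ<|w| i))

  std = standardize v v-inj
  π = proj₁ std
  v⇒π = proj₁ (proj₂ std)
  π⇒v = proj₂ (proj₂ std)

  no-twins : ∀ {k} (f g : Fin k → Fin n) → TightTwins π k f g → ¬ t < k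
  no-twins {k} f g ((f↗ , g↗ , f#g , f~g) , seg) t<k
    with segment⇒merge f g (≤-<-trans z≤n t<k) f↗ g↗ f#g seg | m≤n⇒∃[o]m+o≡n t<k
  ... | a , m , a≤n , k+k≤n∸a , |m| , eq | j , refl =
    good-no-twins N t (n ∸ a) j
      (drop-∈-good N t a (n ∸ a) (subst (λ l → w ∈ good N t l) (sym (m+[n∸m]≡n a≤n)) w∈))
      (k+k≤n∸a , subst (_∈ twinWords N k) word≡
        (merge-∈-twinWords (v ∘ f) (v ∘ g) m z<s |m| (v<N ∘ f) (v<N ∘ g) vf-inj vg-inj
          (order-iso (v ∘ f) (v ∘ g) vg-inj f⇒g g⇒f) (order-iso (v ∘ g) (v ∘ f) vf-inj g⇒f f⇒g)))
    where
    vf-inj : ∀ {i j} → v (f i) ≡ v (f j) → i ≡ j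
    vf-inj = increasing-injective f↗ ∘ v-inj
    vg-inj : ∀ {i j} → v (g i) ≡ v (g j) → i ≡ j
    vg-inj = increasing-injective g↗ ∘ v-inj

    f⇒g : ∀ i j → toℕ i < toℕ j → v (f i) < v (f j) → v (g i) < v (g j)
    f⇒g i j i<j = π⇒v (g i) (g j) ∘ Equivalence.to (f~g i j i<j) ∘ v⇒π (f i) (f j)
    g⇒f : ∀ i j → toℕ i < toℕ j → v (g i) < v (g j) → v (f i) < v (f j)
    g⇒f i j i<j = π⇒v (f i) (f j) ∘ Equivalence.from (f~g i j i<j) ∘ v⇒π (g i) (g j)

    2k+a≤|w| : (k + k) + a ≤ length w
    2k+a≤|w| = subst ((k + k) + a ≤_) (trans (m∸n+n≡m a≤n) (sym |w|)) (+-monoˡ-≤ a k+k≤n∸a)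

    -- Merging commutes with reading entries, so a merge that yields consecutive indices yields a
    -- contiguous block of `w`.
    word≡ : merge m (tabulate (v ∘ f)) (tabulate (v ∘ g)) ≡ take (k + k) (drop a w)
    word≡ = begin
      merge m (tabulate (v ∘ f)) (tabulate (v ∘ g))
        ≡⟨ sym (cong₂ (merge m) (map-tabulate (toℕ ∘ f) (entry w)) (map-tabulate (toℕ ∘ g) (entry w))) ⟩
      merge m (map (entry w) (tabulate (toℕ ∘ f))) (map (entry w) (tabulate (toℕ ∘ g)))
        ≡⟨ sym (map-merge (entry w) m _ _) ⟩
      map (entry w) (merge m (tabulate (toℕ ∘ f)) (tabulate (toℕ ∘ g)))
        ≡⟨ cong (map (entry w)) eq ⟩
      map (entry w) (iterate suc a (k + k))
        ≡⟨ map-entry-iterate (k + k) a w 2k+a≤|w| ⟩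
      take (k + k) (drop a w) ∎
      where open ≡.≡-Reasoning

theorem3p6 : ∀ (n : ℕ) → 1 ≤ n → ttNAtMost n 12
theorem3p6 n 1≤n = let _ , _ , w∈ = good-exists n 1≤n in good⇒ttNAtMost w∈
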